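{- Let $k \ge 2$ and $v$ be integers with $v \equiv 2 \pmod{k-1}$ and $v \ge k(k-1)^2 + 2k$. Then \[ \frac{2v-4}{k-1} \le \beta(2,v,k) \le \frac{2v-4}{k-1} + k^2 - 2. \]
   Context: For integers $v \ge k \ge 2$, a $(v,k)$-packing is a pair $(X,\mathcal{B})$ where $X$ is a set of $v$ points and $\mathcal{B}$ is a set of $k$-subsets of $X$ (blocks) such that every pair of distinct points lies in at most one block. A partial parallel class (PPC) is a set of pairwise disjoint blocks; its size is the number of blocks. A PPC of size $\rho$ is maximum if the packing has no PPC of size $\rho+1$. $\beta(\rho,v,k)$ denotes the maximum number of blocks in a $(v,k)$-packing in which the maximum PPC has size $\rho$. -}

module Defs where

open import Data.Nat using (ℕ; suc; _≤_; _∸_; NonZero; s≤s)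
open import Data.Nat.Properties using (≤-antisym)
open import Data.Fin using (Fin)
open import Data.Fin.Subset using (Subset; _∈_; _∩_; Empty; ∣_∣)
open import Data.List using (List; length)
import Data.List.Membership.Propositional as List
open import Data.List.Relation.Binary.Subset.Propositional using (_⊆_)
open import Data.List.Relation.Unary.All using (All)
open import Data.List.Relation.Unary.AllPairs using (AllPairs)
open import Data.List.Relation.Unary.Unique.Propositional using (Unique)
open import Data.Product using (_×_; _,_; ∃-syntax; Σ-syntax)
open import Relation.Binary.PropositionalEquality using (_≡_; _≢_; refl; subst)
open import Relation.Nullary using (¬_)

-- Finite sets of blocks are duplicate-free lists, so that `length` is
-- cardinality.

record Packing (v k : ℕ) : Set where
  field
    blocks        : List (Subset v)
    blocks-unique : Unique blocks
    blocks-size   : All (λ B → ∣ B ∣ ≡ k) blocks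
    pair-in-≤1    : ∀ {x y : Fin v} → x ≢ y →
                    ∀ {A B} → A List.∈ blocks → B List.∈ blocks →
                    x ∈ A → y ∈ A → x ∈ B → y ∈ B → A ≡ B

open Packing public

#blocks : ∀ {v k} → Packing v k → ℕ
#blocks 𝓟 = length (blocks 𝓟)

Disjoint : ∀ {v} → Subset v → Subset v → Set
Disjoint A B = Empty (A ∩ B)

record PPC {v k : ℕ} (𝓟 : Packing v k) : Set where
  field
    members           : List (Subset v)
    members-unique    : Unique members
    members-blocks    : members ⊆ blocks 𝓟
    pairwise-disjoint : AllPairs Disjoint members

open PPC public

HasPPC : ∀ {v k} → Packing v k → ℕ → Set
HasPPC 𝓟 ρ = Σ[ P ∈ PPC 𝓟 ] length (members P) ≡ ρ

MaxPPCSize : ∀ {v k} → Packing v k → ℕ → Set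
MaxPPCSize 𝓟 ρ = HasPPC 𝓟 ρ × ¬ HasPPC 𝓟 (suc ρ)

-- β(ρ,v,k) is given by its graph: β⟨ ρ , v , k ⟩≡ b says that b is the
-- maximum, attained, of the block counts.  It is functional by β-unique.

β⟨_,_,_⟩≡_ : ℕ → ℕ → ℕ → ℕ → Set
β⟨ ρ , v , k ⟩≡ b =
  (Σ[ 𝓟 ∈ Packing v k ] MaxPPCSize 𝓟 ρ × #blocks 𝓟 ≡ b) ×
  ((𝓟 : Packing v k) → MaxPPCSize 𝓟 ρ → #blocks 𝓟 ≤ b)

β-unique : ∀ {ρ v k b b′} → β⟨ ρ , v , k ⟩≡ b → β⟨ ρ , v , k ⟩≡ b′ → b ≡ b′
β-unique ((𝓟 , m , refl) , ub) ((𝓟′ , m′ , refl) , ub′) =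
  ≤-antisym (ub′ 𝓟 m) (ub 𝓟′ m′)

k∸1-nonZero : ∀ {k} → 2 ≤ k → NonZero (k ∸ 1)
k∸1-nonZero (s≤s (s≤s _)) = _

{-# OPTIONS --safe #-}
module Submission where

-- Upper bound.  Let A, B be disjoint blocks and suppose no three blocks are
-- pairwise disjoint.  Each block misses B, or misses A, or meets both.  Blocks
-- meeting both are determined by a pair in A × B, so there are at most k² of
-- them.  The blocks missing B include A and pairwise intersect: either they all
-- pass through some centre x ∈ A, or each x ∈ A is avoided by a block D of the
-- family, so that at most k of its members pass through x (they meet D in
-- distinct points) and the family has at most 1 + k(k-1) members.  The same
-- holds for the blocks missing A.  Write v = 2 + m(k-1).  A centre has degree at
-- most m + 1, and the block count follows in the cases of no, one or two
-- centres; without a centre the hypothesis on v is exactly what is needed.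
--
-- Lower bound.  Number the points other than ∞₁, ∞₂ by 0, …, m(k-1) - 1.  Join
-- ∞₁ to each interval of k-1 consecutive numbers starting at a multiple of k-1,
-- and ∞₂ to each residue class modulo m.

import Data.Bool as Bool
open import Data.Empty using (⊥)
import Data.Fin as Fin
open import Data.Fin using (Fin; zero; suc; toℕ; combine; cast; fromℕ<)
import Data.Fin.Properties as Fin
open import Data.Fin.Subset using (Subset; _∈_; _∉_; _∩_; _∪_; _-_; ⁅_⁆; ∣_∣; Nonempty; inside; outside)
  renaming (⊥ to ∅)
open import Data.Fin.Subset.Properties
  using (_∈?_; nonempty?; anySubset?; x∈p∩q⁺; x∈p∩q⁻; x∈p∪q⁺; x∈p∪q⁻; x∈⁅x⁆; x∈⁅y⁆⇒x≡y; ∉⊥; p─q⊆p;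
    x∈p∧x≢y⇒x∈p-y; x∈p⇒∣p-x∣<∣p∣)
open import Data.List using (List; []; _∷_; _++_; length; map; concatMap; tabulate)
open import Data.List.Properties using (length-map; length-++; length-tabulate)
import Data.List.Membership.Propositional as List
open import Data.List.Membership.Propositional.Properties
  using (∈-allFin; ∈-map⁺; ∈-map⁻; ∈-concatMap⁻; ∈-tabulate⁺; ∈-tabulate⁻; ∈-++⁺ˡ; ∈-++⁺ʳ; ∈-++⁻)
open import Data.List.Relation.Binary.Subset.Propositional using (_⊆_)
open import Data.List.Relation.Unary.All as All using (All; []; _∷_)
import Data.List.Relation.Unary.All.Properties as All
open import Data.List.Relation.Unary.AllPairs as AllPairs using (AllPairs; []; _∷_)
import Data.List.Relation.Unary.AllPairs.Properties as AllPairs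
open import Data.List.Relation.Unary.Any as Any using (Any; here; there)
open import Data.List.Relation.Unary.Unique.Propositional using (Unique)
import Data.List.Relation.Unary.Unique.Propositional.Properties as Unique
import Data.List.Relation.Unary.Unique.DecPropositional as DecUnique
open import Data.Nat
  using (ℕ; zero; suc; _+_; _*_; _∸_; _^_; _≤_; _<_; _≥_; z≤n; s≤s; NonZero; >-nonZero⁻¹)
open import Data.Nat.DivMod using (_/_; _%_; m*n/n≡m; m≡m%n+[m/n]*n)
open import Data.Nat.Divisibility using (_∣_; divides; quotient; ∣m+n∣m⇒∣n; n∣m*n)
open import Data.Nat.Properties
open import Data.Nat.Tactic.RingSolver using (solve-∀)
open import Data.Product using (_×_; _,_; proj₁; proj₂; ∃; ∃-syntax)
open import Data.Sum using (_⊎_; inj₁; inj₂)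
open import Data.Vec using (_∷_; []; here; there)
open import Data.Vec.Properties using (≡-dec)
open import Function using (_∘_; id)
open import Relation.Binary.Definitions using (tri<; tri≈; tri>)
open import Relation.Binary.PropositionalEquality
open import Relation.Nullary
open import Relation.Nullary.Decidable using (map′; decidable-stable)
open import Defs

-- Counting with duplicate-free lists.

-- A cardinality bound in terms of duplicate-free lists: it makes sense for a predicate that is
-- neither enumerated nor decided, and it applies directly to `blocks 𝓟`.
_at-most_ : {A : Set} → (A → Set) → ℕ → Set
P at-most n = ∀ {xs} → Unique xs → All P xs → length xs ≤ n

at-most-⊆ : {A : Set} {P Q : A → Set} {n : ℕ} → (∀ {x} → P x → Q x) → Q at-most n → P at-most n
at-most-⊆ P⊆Q q u ps = q u (All.map P⊆Q ps)

at-most-≤ : {A : Set} {P : A → Set} {m n : ℕ} → m ≤ n → P at-most m → P at-most n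
at-most-≤ m≤n p u ps = ≤-trans (p u ps) m≤n

at-most-1 : {A : Set} {P : A → Set} → (∀ {x y} → P x → P y → x ≡ y) → P at-most 1
at-most-1 eq {[]} _ _ = z≤n
at-most-1 eq {_ ∷ []} _ _ = s≤s z≤n
at-most-1 eq {_ ∷ _ ∷ _} ((x≢y ∷ _) ∷ _) (px ∷ py ∷ _) = contradiction (eq px py) x≢y

-- The inclusions in `xs` are carried along for the recursion: the head differs from every entry of
-- either part because the parts lie inside the tail.
splitUnique : {A : Set} {P Q : A → Set} {xs : List A} → Unique xs → All (λ x → P x ⊎ Q x) xs →
  ∃[ ys ] ∃[ zs ] (Unique ys × All P ys × ys ⊆ xs) × (Unique zs × All Q zs × zs ⊆ xs) ×
    length xs ≡ length ys + length zs
splitUnique [] [] = [] , [] , ([] , [] , id) , ([] , [] , id) , refl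
splitUnique (x≢ ∷ u) (pq ∷ pqs) with splitUnique u pqs
splitUnique (x≢ ∷ u) (inj₁ p ∷ pqs) | ys , zs , (uy , ps , ys⊆) , (uz , qs , zs⊆) , eq =
  _ ∷ ys , zs , (All.anti-mono ys⊆ x≢ ∷ uy , p ∷ ps , λ { (here e) → here e ; (there i) → there (ys⊆ i) })
  , (uz , qs , there ∘ zs⊆) , cong suc eq
splitUnique (x≢ ∷ u) (inj₂ q ∷ pqs) | ys , zs , (uy , ps , ys⊆) , (uz , qs , zs⊆) , eq =
  ys , _ ∷ zs , (uy , ps , there ∘ ys⊆)
  , (All.anti-mono zs⊆ x≢ ∷ uz , q ∷ qs , λ { (here e) → here e ; (there i) → there (zs⊆ i) })
  , trans (cong suc eq) (sym (+-suc _ _))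

at-most-⊎ : {A : Set} {P Q : A → Set} {m n : ℕ} → P at-most m → Q at-most n → (λ x → P x ⊎ Q x) at-most (m + n)
at-most-⊎ {m = m} {n} p q u pqs with splitUnique u pqs
... | ys , zs , (uy , ps , _) , (uz , qs , _) , eq = subst (_≤ m + n) (sym eq) (+-mono-≤ (p uy ps) (q uz qs))

-- Union bound, by induction on the indices: a witness sits either at the head or in the tail.
at-most-Any : {A B : Set} {R : B → A → Set} {n : ℕ} (js : List B) →
  (∀ {j} → j List.∈ js → R j at-most n) → (λ x → Any (λ j → R j x) js) at-most (length js * n)
at-most-Any [] _ {[]} _ _ = z≤n
at-most-Any [] _ {_ ∷ _} _ (() ∷ _)
at-most-Any (j ∷ js) r = at-most-⊆ Any.toSum (at-most-⊎ (r (here refl)) (at-most-Any js (r ∘ there)))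

-- Membership is a union of singletons, so the union bound with one element per index gives the
-- pigeonhole principle.
at-most-∈ : {A : Set} (ys : List A) → (List._∈ ys) at-most (length ys)
at-most-∈ ys = at-most-≤ (≤-reflexive (*-identityʳ (length ys)))
  (at-most-Any ys (λ _ → at-most-1 (λ p q → trans p (sym q))))

unique-⊆⇒length≤ : {A : Set} {xs ys : List A} → Unique xs → xs ⊆ ys → length xs ≤ length ys
unique-⊆⇒length≤ u xs⊆ys = at-most-∈ _ u (All.tabulate xs⊆ys)

-- Subsets of `Fin n` as lists.

elements : ∀ {n} → Subset n → List (Fin n)
elements [] = []
elements (inside ∷ p) = zero ∷ map suc (elements p)
elements (outside ∷ p) = map suc (elements p)

length-elements : ∀ {n} (p : Subset n) → length (elements p) ≡ ∣ p ∣
length-elements [] = refl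
length-elements (inside ∷ p) = cong suc (trans (length-map suc (elements p)) (length-elements p))
length-elements (outside ∷ p) = trans (length-map suc (elements p)) (length-elements p)

∈-elements⁺ : ∀ {n} {p : Subset n} {x} → x ∈ p → x List.∈ elements p
∈-elements⁺ here = here refl
∈-elements⁺ {p = inside ∷ p} (there x∈p) = there (∈-map⁺ suc (∈-elements⁺ x∈p))
∈-elements⁺ {p = outside ∷ p} (there x∈p) = ∈-map⁺ suc (∈-elements⁺ x∈p)

∈-elements⁻ : ∀ {n} (p : Subset n) {x} → x List.∈ elements p → x ∈ p
∈-elements⁻ (inside ∷ p) (here refl) = here
∈-elements⁻ (inside ∷ p) (there x∈) with ∈-map⁻ suc x∈
... | _ , y∈ , refl = there (∈-elements⁻ p y∈)
∈-elements⁻ (outside ∷ p) x∈ with ∈-map⁻ suc x∈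
... | _ , y∈ , refl = there (∈-elements⁻ p y∈)

elements-unique : ∀ {n} (p : Subset n) → Unique (elements p)
elements-unique [] = []
elements-unique (inside ∷ p) =
  All.map⁺ (All.tabulate (λ _ ())) ∷ Unique.map⁺ Fin.suc-injective (elements-unique p)
elements-unique (outside ∷ p) = Unique.map⁺ Fin.suc-injective (elements-unique p)

unique⇒length≤ : ∀ {n} {xs : List (Fin n)} → Unique xs → length xs ≤ n
unique⇒length≤ {n} {xs} u = subst (length xs ≤_) (length-tabulate id) (unique-⊆⇒length≤ u (λ _ → ∈-allFin _))

x∉p-x : ∀ {n} (p : Subset n) x → x ∉ p - x
x∉p-x (inside ∷ p) zero ()
x∉p-x (outside ∷ p) zero ()
x∉p-x (inside ∷ p) (suc x) (there x∈) = x∉p-x p x x∈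
x∉p-x (outside ∷ p) (suc x) (there x∈) = x∉p-x p x x∈

x∈p-y⁻ : ∀ {n} (p : Subset n) {x y} → x ∈ p - y → x ∈ p × x ≢ y
x∈p-y⁻ p x∈ = p─q⊆p p _ x∈ , λ { refl → x∉p-x p _ x∈ }

∣p∣≤1+∣p-x∣ : ∀ {n} (p : Subset n) x → ∣ p ∣ ≤ suc ∣ p - x ∣
∣p∣≤1+∣p-x∣ p x = subst₂ _≤_ (length-elements p) (cong suc (length-elements (p - x)))
  (unique-⊆⇒length≤ (elements-unique p) sub)
  where
  sub : elements p ⊆ x ∷ elements (p - x)
  sub {z} z∈ with z Fin.≟ x
  ... | yes z≡x = here z≡x
  ... | no z≢x = there (∈-elements⁺ (x∈p∧x≢y⇒x∈p-y (∈-elements⁻ p z∈) z≢x))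

AllPairs-map-All : {A : Set} {P : A → Set} {R S : A → A → Set} {xs : List A} →
  (∀ {x y} → P x → P y → R x y → S x y) → All P xs → AllPairs R xs → AllPairs S xs
AllPairs-map-All f [] [] = []
AllPairs-map-All f (px ∷ pxs) (rx ∷ rxs) =
  All.zipWith (λ (py , r) → f px py r) (pxs , rx) ∷ AllPairs-map-All f pxs rxs

length*≤length-concatMap : {A B : Set} {f : A → List B} {n : ℕ} {xs : List A} →
  All (λ x → n ≤ length (f x)) xs → length xs * n ≤ length (concatMap f xs)
length*≤length-concatMap [] = z≤n
length*≤length-concatMap {f = f} {xs = x ∷ xs} (n≤ ∷ ns) =
  subst (_ ≤_) (sym (length-++ (f x))) (+-mono-≤ n≤ (length*≤length-concatMap ns))

-- Disjoint and meeting subsets.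

disjoint? : ∀ {v} (C D : Subset v) → Dec (Disjoint C D)
disjoint? C D = ¬? (nonempty? (C ∩ D))

Disjoint-sym : ∀ {v} {C D : Subset v} → Disjoint C D → Disjoint D C
Disjoint-sym {C = C} {D} d (x , x∈) = let x∈D , x∈C = x∈p∩q⁻ D C x∈ in d (x , x∈p∩q⁺ (x∈C , x∈D))

_≟ₛ_ : ∀ {v} (C D : Subset v) → Dec (C ≡ D)
_≟ₛ_ = ≡-dec Bool._≟_

-- A list and `Any` in place of a nonempty intersection, so that `at-most-Any` can sum over the
-- points met.
Meets : ∀ {v} → Subset v → List (Fin v) → Set
Meets C xs = Any (_∈ C) xs

meets-elements : ∀ {v} {C D : Subset v} → Nonempty (C ∩ D) → Meets C (elements D)
meets-elements {C = C} {D} (x , x∈) =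
  let x∈C , x∈D = x∈p∩q⁻ C D x∈ in Any.map (λ { refl → x∈C }) (∈-elements⁺ x∈D)

contains-or-meets : ∀ {v} {C D : Subset v} x → Nonempty (C ∩ D) → x ∈ C ⊎ Meets C (elements (D - x))
contains-or-meets {C = C} {D} x (z , z∈) with x∈p∩q⁻ C D z∈ | z Fin.≟ x
... | z∈C , _ | yes refl = inj₁ z∈C
... | z∈C , z∈D | no z≢x = inj₂ (Any.map (λ { refl → z∈C }) (∈-elements⁺ (x∈p∧x≢y⇒x∈p-y z∈D z≢x)))

-- Counting blocks through given points.

module _ {v k : ℕ} (𝓟 : Packing v k) where

  ∣block∣ : ∀ {C} → C List.∈ blocks 𝓟 → ∣ C ∣ ≡ k
  ∣block∣ = All.lookup (blocks-size 𝓟)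

  length-block : ∀ {C} → C List.∈ blocks 𝓟 → length (elements C) ≤ k
  length-block {C} C∈ = ≤-reflexive (trans (length-elements C) (∣block∣ C∈))

  length-punctured : ∀ {C x} → C List.∈ blocks 𝓟 → x ∈ C → length (elements (C - x)) ≤ k ∸ 1
  length-punctured {C} {x} C∈ x∈C = subst₂ (λ a b → a ≤ b ∸ 1) (sym (length-elements (C - x))) (∣block∣ C∈)
    (∸-monoˡ-≤ 1 (x∈p⇒∣p-x∣<∣p∣ x∈C))

  through-pair : ∀ {x y} → x ≢ y → (λ C → C List.∈ blocks 𝓟 × x ∈ C × y ∈ C) at-most 1
  through-pair x≢y = at-most-1 (λ (C∈ , x∈C , y∈C) (D∈ , x∈D , y∈D) →
    pair-in-≤1 𝓟 x≢y C∈ D∈ x∈C y∈C x∈D y∈D)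

  -- Such a block contains some `x` of `xs` and some `y` of `ys`. These are distinct, so they
  -- determine it; one union bound over each list gives the product.
  meeting-both : ∀ xs ys → (∀ {x y} → x List.∈ xs → y List.∈ ys → x ≢ y) →
    (λ C → C List.∈ blocks 𝓟 × Meets C xs × Meets C ys) at-most (length xs * length ys)
  meeting-both xs ys xs≢ys =
    at-most-⊆ (λ (C∈ , mx , my) → Any.map (λ x∈C → C∈ , x∈C , my) mx)
      (at-most-Any {R = λ x C → C List.∈ blocks 𝓟 × x ∈ C × Meets C ys} xs (λ x∈xs →
        at-most-⊆ (λ (C∈ , x∈C , my) → Any.map (λ y∈C → C∈ , x∈C , y∈C) my)
          (at-most-≤ (≤-reflexive (*-identityʳ (length ys)))
            (at-most-Any {R = λ y C → C List.∈ blocks 𝓟 × _ ∈ C × y ∈ C} ys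
              (λ y∈ys → through-pair (xs≢ys x∈xs y∈ys))))))

  -- Each of these blocks contains `x` and a point of `D`, necessarily different from `x`; this is
  -- `meeting-both` with `x` as the only entry of the first list.
  through-meeting : ∀ {x D} → D List.∈ blocks 𝓟 → x ∉ D →
    (λ C → C List.∈ blocks 𝓟 × x ∈ C × Nonempty (C ∩ D)) at-most k
  through-meeting {x} {D} D∈ x∉D =
    at-most-⊆ (λ (C∈ , x∈C , ne) → C∈ , here x∈C , meets-elements ne)
      (at-most-≤ (≤-reflexive (trans (*-identityˡ _) (trans (length-elements D) (∣block∣ D∈))))
        (meeting-both (x ∷ []) (elements D) (λ { (here refl) y∈ refl → x∉D (∈-elements⁻ D y∈) })))

  -- The members other than `A` are sorted by a point `x` that they share with `A`, at most `k ∸ 1`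
  -- for each `x`.
  intersecting-without-centre : {F : Subset v → Set} {A : Subset v} →
    (∀ {C} → F C → C List.∈ blocks 𝓟) → (∀ {C D} → F C → F D → Nonempty (C ∩ D)) →
    F A → (∀ {x} → x ∈ A → ∃[ D ] F D × x ∉ D) → F at-most (1 + k * (k ∸ 1))
  intersecting-without-centre {F} {A} F⊆ F-meets FA avoid =
    at-most-⊆ cases (at-most-⊎ (at-most-1 (λ p q → trans p (sym q)))
      (at-most-≤ (≤-reflexive (cong (_* (k ∸ 1)) (trans (length-elements A) (∣block∣ (F⊆ FA)))))
        (at-most-Any {R = λ x C → F C × C ≢ A × x ∈ C} (elements A) others)))
    where
    cases : ∀ {C} → F C → C ≡ A ⊎ Any (λ x → F C × C ≢ A × x ∈ C) (elements A)
    cases {C} FC with C ≟ₛ A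
    ... | yes C≡A = inj₁ C≡A
    ... | no C≢A = inj₂ (Any.map (λ x∈C → FC , C≢A , x∈C) (meets-elements (F-meets FC FA)))
    others : ∀ {x} → x List.∈ elements A → (λ C → F C × C ≢ A × x ∈ C) at-most (k ∸ 1)
    others x∈ u fs with avoid (∈-elements⁻ A x∈)
    -- `A` also passes through `x` and meets `D`. Prepending it to the list uses up one of the `k`
    -- places, which leaves `k ∸ 1` for the others.
    ... | D , FD , x∉D = ∸-monoˡ-≤ 1 (through-meeting (F⊆ FD) x∉D
      (All.map (λ (_ , C≢A , _) A≡C → C≢A (sym A≡C)) fs ∷ u)
      ((F⊆ FA , ∈-elements⁻ A x∈ , F-meets FA FD)
        ∷ All.map (λ (FC , _ , x∈C) → F⊆ FC , x∈C , F-meets FC FD) fs))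

  -- Distinct blocks through `x` share no other point, so with `x` removed they are pairwise
  -- disjoint and have `k ∸ 1` points each. Neither `x` nor `y` is among these points, which
  -- accounts for the 2.
  avoiding-bound : ∀ {x y} → x ≢ y → {Cs : List (Subset v)} → Unique Cs →
    All (λ C → C List.∈ blocks 𝓟 × x ∈ C × y ∉ C) Cs → 2 + length Cs * (k ∸ 1) ≤ v
  avoiding-bound {x} {y} x≢y {Cs} u cs =
    ≤-trans (+-monoʳ-≤ 2 (length*≤length-concatMap (All.map long cs)))
      (unique⇒length≤ ((x≢y ∷ All.tabulate x∉) ∷ All.tabulate y∉ ∷ unique))
    where
    points : Subset v → List (Fin v)
    points C = elements (C - x)
    long : ∀ {C} → C List.∈ blocks 𝓟 × x ∈ C × y ∉ C → k ∸ 1 ≤ length (points C)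
    long {C} (C∈ , _) = subst₂ (λ a b → a ∸ 1 ≤ b) (∣block∣ C∈) (sym (length-elements (C - x)))
      (∸-monoˡ-≤ 1 (∣p∣≤1+∣p-x∣ C x))
    x∉ : ∀ {z} → z List.∈ concatMap points Cs → x ≢ z
    x∉ z∈ refl with Any.satisfied (∈-concatMap⁻ points {xs = Cs} z∈)
    ... | C , x∈ = x∉p-x C x (∈-elements⁻ (C - x) x∈)
    y∉ : ∀ {z} → z List.∈ concatMap points Cs → y ≢ z
    y∉ z∈ refl with List.find (∈-concatMap⁻ points {xs = Cs} z∈)
    ... | C , C∈ , y∈ = proj₂ (proj₂ (All.lookup cs C∈)) (proj₁ (x∈p-y⁻ C (∈-elements⁻ (C - x) y∈)))
    unique : Unique (concatMap points Cs)
    unique = Unique.concat⁺ (All.map⁺ (All.tabulate (λ {C} _ → elements-unique (C - x))))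
      (AllPairs.map⁺ (AllPairs-map-All (λ {C} {D} (C∈ , x∈C , _) (D∈ , x∈D , _) C≢D (z∈C , z∈D) →
        let z∈C′ , z≢x = x∈p-y⁻ C (∈-elements⁻ (C - x) z∈C)
            z∈D′ , _ = x∈p-y⁻ D (∈-elements⁻ (D - x) z∈D)
        in C≢D (pair-in-≤1 𝓟 z≢x C∈ D∈ z∈C′ x∈C z∈D′ x∈D)) cs u))

-- Here `k = suc n` and `v = 2 + m * n`. Besides `x` and `y` there are exactly `m * n` points, room
-- for `m` disjoint sets of `n`.
avoiding-at-most : ∀ {n m} .{{_ : NonZero n}} (𝓟 : Packing (2 + m * n) (suc n)) {x y} → x ≢ y →
  (λ C → C List.∈ blocks 𝓟 × x ∈ C × y ∉ C) at-most m
avoiding-at-most {n} {m} 𝓟 x≢y {Cs} u cs =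
  *-cancelʳ-≤ (length Cs) m n (+-cancelˡ-≤ 2 _ _ (avoiding-bound 𝓟 x≢y u cs))

-- For any second point `y`, at most `m` blocks through `x` avoid `y` and at most one contains it.
degree-at-most : ∀ {n m} .{{_ : NonZero n}} (𝓟 : Packing (2 + m * n) (suc n)) x →
  (λ C → C List.∈ blocks 𝓟 × x ∈ C) at-most (m + 1)
degree-at-most {n} {m} 𝓟 x = at-most-⊆ cases (at-most-⊎ (avoiding-at-most 𝓟 x≢y) (through-pair 𝓟 x≢y))
  where
  other : ∀ (x : Fin (2 + m * n)) → ∃[ y ] x ≢ y
  other zero = suc zero , λ ()
  other (suc _) = zero , λ ()
  y = proj₁ (other x)
  x≢y = proj₂ (other x)
  cases : ∀ {C} → C List.∈ blocks 𝓟 × x ∈ C →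
    (C List.∈ blocks 𝓟 × x ∈ C × y ∉ C) ⊎ (C List.∈ blocks 𝓟 × x ∈ C × y ∈ C)
  cases {C} (C∈ , x∈C) with y ∈? C
  ... | yes y∈C = inj₂ (C∈ , x∈C , y∈C)
  ... | no y∉C = inj₁ (C∈ , x∈C , y∉C)

-- Two disjoint blocks and their centres.

NoThreeDisjoint : ∀ {v k} → Packing v k → Set
NoThreeDisjoint 𝓟 = ∀ {C D E} → C List.∈ blocks 𝓟 → D List.∈ blocks 𝓟 → E List.∈ blocks 𝓟 →
  Disjoint C D → Disjoint C E → Disjoint D E → ⊥

Centre : ∀ {v k} → Packing v k → Subset v → Subset v → Set
Centre 𝓟 A B = ∃[ x ] x ∈ A × (∀ {C} → C List.∈ blocks 𝓟 → Disjoint C B → x ∈ C)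

-- Two disjoint blocks that both avoid B would extend {B} to three disjoint blocks.
centre-or-few : ∀ {v k} (𝓟 : Packing v k) → NoThreeDisjoint 𝓟 → ∀ {A B} →
  A List.∈ blocks 𝓟 → B List.∈ blocks 𝓟 → Disjoint A B →
  Centre 𝓟 A B ⊎ (λ C → C List.∈ blocks 𝓟 × Disjoint C B) at-most (1 + k * (k ∸ 1))
centre-or-few 𝓟 no3 {A} {B} A∈ B∈ A#B
  with Fin.any? (λ x → (x ∈? A) ×-dec All.all? (λ C → disjoint? C B →-dec (x ∈? C)) (blocks 𝓟))
... | yes (x , x∈A , star) = inj₁ (x , x∈A , λ C∈ → All.lookup star C∈)
... | no ¬star = inj₂ (intersecting-without-centre 𝓟 proj₁
  (λ {C} {D} (C∈ , C#B) (D∈ , D#B) →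
    decidable-stable (nonempty? (C ∩ D)) (λ C#D → no3 C∈ D∈ B∈ C#D C#B D#B))
  (A∈ , A#B) avoid)
  where
  avoid : ∀ {x} → x ∈ A → ∃[ D ] (D List.∈ blocks 𝓟 × Disjoint D B) × x ∉ D
  avoid {x} x∈A with List.find (All.¬All⇒Any¬ (λ C → disjoint? C B →-dec (x ∈? C)) (blocks 𝓟)
    (λ all → ¬star (x , x∈A , all)))
  ... | D , D∈ , ¬imp =
    D , (D∈ , decidable-stable (disjoint? D B) (λ ¬d → ¬imp (λ d → contradiction d ¬d)))
      , λ x∈D → ¬imp (λ _ → x∈D)

module _ {v k : ℕ} (𝓟 : Packing v k) (A B : Subset v)
  (A∈ : A List.∈ blocks 𝓟) (B∈ : B List.∈ blocks 𝓟) (A#B : Disjoint A B) where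

  disjoint⇒≢ : ∀ {x y} → x ∈ A → y ∈ B → x ≢ y
  disjoint⇒≢ x∈A y∈B refl = A#B (_ , x∈p∩q⁺ (x∈A , y∈B))

  bound-no-centre : ∀ {f} → (λ C → C List.∈ blocks 𝓟 × Disjoint C B) at-most f →
    (λ C → C List.∈ blocks 𝓟 × Disjoint C A) at-most f →
    (List._∈ blocks 𝓟) at-most (f + (f + k * k))
  bound-no-centre fa fb = at-most-⊆ cases (at-most-⊎ fa (at-most-⊎ fb
      (at-most-≤ (*-mono-≤ (length-block 𝓟 A∈) (length-block 𝓟 B∈))
        (meeting-both 𝓟 (elements A) (elements B)
          (λ x∈ y∈ → disjoint⇒≢ (∈-elements⁻ A x∈) (∈-elements⁻ B y∈))))))
    where
    cases : ∀ {C} → C List.∈ blocks 𝓟 → (C List.∈ blocks 𝓟 × Disjoint C B) ⊎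
      ((C List.∈ blocks 𝓟 × Disjoint C A) ⊎
       (C List.∈ blocks 𝓟 × Meets C (elements A) × Meets C (elements B)))
    cases {C} C∈ with nonempty? (C ∩ B) | nonempty? (C ∩ A)
    ... | no C#B | _ = inj₁ (C∈ , C#B)
    ... | yes _ | no C#A = inj₂ (inj₁ (C∈ , C#A))
    ... | yes nb | yes na = inj₂ (inj₂ (C∈ , meets-elements na , meets-elements nb))

  -- The blocks that miss `B` all pass through `x`. A block that avoids `x` and meets both `A` and
  -- `B` meets `A` in one of its other `k ∸ 1` points, so one factor `k` drops to `k ∸ 1`.
  bound-one-centre : ∀ {f d} → ((x , _) : Centre 𝓟 A B) → (λ C → C List.∈ blocks 𝓟 × x ∈ C) at-most d →
    (λ C → C List.∈ blocks 𝓟 × Disjoint C A) at-most f →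
    (List._∈ blocks 𝓟) at-most (d + (f + (k ∸ 1) * k))
  bound-one-centre (x , x∈A , star) dx fb = at-most-⊆ cases (at-most-⊎ dx (at-most-⊎ fb
      (at-most-≤ (*-mono-≤ (length-punctured 𝓟 A∈ x∈A) (length-block 𝓟 B∈))
        (meeting-both 𝓟 (elements (A - x)) (elements B)
          (λ y∈ z∈ → disjoint⇒≢ (proj₁ (x∈p-y⁻ A (∈-elements⁻ (A - x) y∈))) (∈-elements⁻ B z∈))))))
    where
    cases : ∀ {C} → C List.∈ blocks 𝓟 → (C List.∈ blocks 𝓟 × x ∈ C) ⊎
      ((C List.∈ blocks 𝓟 × Disjoint C A) ⊎
       (C List.∈ blocks 𝓟 × Meets C (elements (A - x)) × Meets C (elements B)))
    cases {C} C∈ with nonempty? (C ∩ B) | nonempty? (C ∩ A)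
    ... | no C#B | _ = inj₁ (C∈ , star C∈ C#B)
    ... | yes _ | no C#A = inj₂ (inj₁ (C∈ , C#A))
    ... | yes nb | yes na with contains-or-meets x na
    ...   | inj₁ x∈C = inj₁ (C∈ , x∈C)
    ...   | inj₂ mx = inj₂ (inj₂ (C∈ , mx , meets-elements nb))

  -- Blocks through both centres are counted with `x` only, so that the second class has the bound
  -- `d` in place of `d + 1`. A block avoiding both centres must meet `A` and `B`, away from `x` and
  -- `y`.
  bound-two-centres : ∀ {d} → Centre 𝓟 A B → Centre 𝓟 B A →
    (∀ {x y} → x ≢ y → (λ C → C List.∈ blocks 𝓟 × x ∈ C × y ∉ C) at-most d) →
    (∀ x → (λ C → C List.∈ blocks 𝓟 × x ∈ C) at-most (d + 1)) →
    (List._∈ blocks 𝓟) at-most (d + 1 + (d + (k ∸ 1) * (k ∸ 1)))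
  bound-two-centres (x , x∈A , starA) (y , y∈B , starB) dxy dx =
    at-most-⊆ cases (at-most-⊎ (dx x) (at-most-⊎ (dxy (disjoint⇒≢ x∈A y∈B ∘ sym))
      (at-most-≤ (*-mono-≤ (length-punctured 𝓟 A∈ x∈A) (length-punctured 𝓟 B∈ y∈B))
        (meeting-both 𝓟 (elements (A - x)) (elements (B - y))
          (λ p∈ q∈ → disjoint⇒≢ (proj₁ (x∈p-y⁻ A (∈-elements⁻ (A - x) p∈)))
                         (proj₁ (x∈p-y⁻ B (∈-elements⁻ (B - y) q∈))))))))
    where
    cases : ∀ {C} → C List.∈ blocks 𝓟 → (C List.∈ blocks 𝓟 × x ∈ C) ⊎
      ((C List.∈ blocks 𝓟 × y ∈ C × x ∉ C) ⊎
       (C List.∈ blocks 𝓟 × Meets C (elements (A - x)) × Meets C (elements (B - y))))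
    cases {C} C∈ with x ∈? C | y ∈? C
    ... | yes x∈C | _ = inj₁ (C∈ , x∈C)
    ... | no x∉C | yes y∈C = inj₂ (inj₁ (C∈ , y∈C , x∉C))
    ... | no x∉C | no y∉C with nonempty? (C ∩ B) | nonempty? (C ∩ A)
    ...   | no C#B | _ = contradiction (starA C∈ C#B) x∉C
    ...   | yes _ | no C#A = contradiction (starB C∈ C#A) y∉C
    ...   | yes nb | yes na with contains-or-meets x na | contains-or-meets y nb
    ...     | inj₁ x∈C | _ = contradiction x∈C x∉C
    ...     | inj₂ _ | inj₁ y∈C = contradiction y∈C y∉C
    ...     | inj₂ mx | inj₂ my = inj₂ (inj₂ (C∈ , mx , my))

-- Partial parallel classes and the upper bound.

-- The conditions on a partial parallel class for a bare list of blocks, all in decidable form, so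
-- that `attained?` can search for one.
HasMatching : ∀ {v} → List (Subset v) → ℕ → Set
HasMatching Bs ρ = ∃[ M ] length M ≡ ρ × Unique M × All (List._∈ Bs) M × AllPairs Disjoint M

HasPPC⇒HasMatching : ∀ {v k ρ} (𝓟 : Packing v k) → HasPPC 𝓟 ρ → HasMatching (blocks 𝓟) ρ
HasPPC⇒HasMatching _ (P , eq) =
  members P , eq , members-unique P , All.tabulate (members-blocks P) , pairwise-disjoint P

HasMatching⇒HasPPC : ∀ {v k ρ} (𝓟 : Packing v k) → HasMatching (blocks 𝓟) ρ → HasPPC 𝓟 ρ
HasMatching⇒HasPPC _ (M , eq , u , M∈ , d) = record
  { members = M ; members-unique = u ; members-blocks = All.lookup M∈ ; pairwise-disjoint = d } , eq

block-nonempty : ∀ {v n} (𝓟 : Packing v (suc n)) {C} → C List.∈ blocks 𝓟 → Nonempty C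
block-nonempty 𝓟 {C} C∈ with elements C in eq
... | [] = contradiction (trans (cong length (sym eq)) (trans (length-elements C) (∣block∣ 𝓟 C∈))) λ ()
... | x ∷ _ = x , ∈-elements⁻ C (subst (x List.∈_) (sym eq) (here refl))

-- An empty block would be disjoint from itself; the size `suc n` excludes this. Disjointness thus
-- supplies the distinctness that a `PPC` requires.
disjoint-blocks-≢ : ∀ {v n} (𝓟 : Packing v (suc n)) {C D} → C List.∈ blocks 𝓟 → Disjoint C D → C ≢ D
disjoint-blocks-≢ 𝓟 C∈ C#D refl = let x , x∈C = block-nonempty 𝓟 C∈ in C#D (x , x∈p∩q⁺ (x∈C , x∈C))

¬HasPPC3⇒NoThreeDisjoint : ∀ {v n} (𝓟 : Packing v (suc n)) → ¬ HasPPC 𝓟 3 → NoThreeDisjoint 𝓟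
¬HasPPC3⇒NoThreeDisjoint 𝓟 ¬3 C∈ D∈ E∈ C#D C#E D#E = ¬3 (HasMatching⇒HasPPC 𝓟
  ( _ ∷ _ ∷ _ ∷ [] , refl
  , (disjoint-blocks-≢ 𝓟 C∈ C#D ∷ disjoint-blocks-≢ 𝓟 C∈ C#E ∷ []) ∷ (disjoint-blocks-≢ 𝓟 D∈ D#E ∷ []) ∷ [] ∷ []
  , C∈ ∷ D∈ ∷ E∈ ∷ [] , (C#D ∷ C#E ∷ []) ∷ (D#E ∷ []) ∷ [] ∷ []))

-- The 2 of k² - 2 stands on the left, since subtraction on ℕ is truncated.
bounds-arithmetic : ∀ n m .{{_ : NonZero n}} → n * n + n + 2 ≤ m → let k = suc n; f = 1 + k * n in
  (f + (f + k * k) + 2 ≤ 2 * m + k * k) ×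
  (m + 1 + (f + n * k) + 2 ≤ 2 * m + k * k) ×
  (m + 1 + (m + n * n) + 2 ≤ 2 * m + k * k)
bounds-arithmetic n m le with m≤n⇒∃[o]m+o≡n le
... | t , refl =
    -- With `m = n * n + n + 2 + t`, the right sides exceed the left by `2 * t`, `n + t - 1` and
    -- `2 * n - 2`; `slack` receives the negative part as `d` and the positive part as `c`. The
    -- first case is tight at `t = 0`.
    slack 0 (2 * t) z≤n (trans (e₁ n t) (sym (+-identityʳ _)))
  , slack 1 (n + t) (≤-trans (>-nonZero⁻¹ n) (m≤m+n n t)) (e₂ n t)
  , slack 2 (2 * n) (*-monoʳ-≤ 2 (>-nonZero⁻¹ n)) (e₃ n t)
  where
  slack : ∀ {a b} d c → d ≤ c → a + c ≡ b + d → a ≤ b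
  slack {a} {b} d c d≤c eq = +-cancelʳ-≤ d a b (≤-trans (+-monoʳ-≤ a d≤c) (≤-reflexive eq))
  e₁ : ∀ n t → let k = 1 + n; f = 1 + k * n in
    f + (f + k * k) + 2 + 2 * t ≡ 2 * (n * n + n + 2 + t) + k * k
  e₁ = solve-∀
  e₂ : ∀ n t → let k = 1 + n; f = 1 + k * n; m = n * n + n + 2 + t in
    m + 1 + (f + n * k) + 2 + (n + t) ≡ 2 * m + k * k + 1
  e₂ = solve-∀
  e₃ : ∀ n t → let k = 1 + n; m = n * n + n + 2 + t in
    m + 1 + (m + n * n) + 2 + 2 * n ≡ 2 * m + k * k + 2
  e₃ = solve-∀

upper-bound : ∀ n m .{{_ : NonZero n}} → n * n + n + 2 ≤ m → (𝓟 : Packing (2 + m * n) (suc n)) →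
  MaxPPCSize 𝓟 2 → #blocks 𝓟 ≤ 2 * m + (suc n ^ 2 ∸ 2)
upper-bound n m m-large 𝓟 (ppc , ¬3) with HasPPC⇒HasMatching 𝓟 ppc | bounds-arithmetic n m m-large
... | A ∷ B ∷ [] , refl , _ , A∈ ∷ B∈ ∷ [] , (A#B ∷ []) ∷ _ | none , one , two =
  -- The 2 returns to the right side here; `2≤k²` keeps the truncated subtraction exact.
  subst (#blocks 𝓟 ≤_) (+-∸-assoc (2 * m) 2≤k²) (m+n≤o⇒m≤o∸n (#blocks 𝓟)
    (subst (λ z → #blocks 𝓟 + 2 ≤ 2 * m + z) (sym k^2≡k*k) bound))
  where
  k^2≡k*k : suc n ^ 2 ≡ suc n * suc n
  k^2≡k*k = cong (suc n *_) (*-identityʳ (suc n))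
  2≤k² : 2 ≤ suc n ^ 2
  2≤k² = ≤-trans (*-mono-≤ {2} {suc n} {1} {suc n} (s≤s (>-nonZero⁻¹ n)) (s≤s z≤n)) (≤-reflexive (sym k^2≡k*k))
  B#A : Disjoint B A
  B#A = Disjoint-sym A#B
  count : ∀ {b} → (List._∈ blocks 𝓟) at-most b → b + 2 ≤ 2 * m + suc n * suc n →
    #blocks 𝓟 + 2 ≤ 2 * m + suc n * suc n
  count p = ≤-trans (+-monoˡ-≤ 2 (p (blocks-unique 𝓟) (All.tabulate id)))
  no3 : NoThreeDisjoint 𝓟
  no3 = ¬HasPPC3⇒NoThreeDisjoint 𝓟 ¬3
  bound : #blocks 𝓟 + 2 ≤ 2 * m + suc n * suc n
  bound with centre-or-few 𝓟 no3 A∈ B∈ A#B | centre-or-few 𝓟 no3 B∈ A∈ B#A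
  ... | inj₁ a | inj₁ b = count (bound-two-centres 𝓟 A B A∈ B∈ A#B {d = m} a b
    (avoiding-at-most {m = m} 𝓟) (degree-at-most {m = m} 𝓟)) two
  ... | inj₁ a | inj₂ fb = count (bound-one-centre 𝓟 A B A∈ B∈ A#B a (degree-at-most {m = m} 𝓟 _) fb) one
  ... | inj₂ fa | inj₁ b = count (bound-one-centre 𝓟 B A B∈ A∈ B#A b (degree-at-most {m = m} 𝓟 _) fa) one
  ... | inj₂ fa | inj₂ fb = count (bound-no-centre 𝓟 A B A∈ B∈ A#B fa fb) none

-- Existence of the maximum by exhaustive search.

-- A fixed length leaves finitely many lists of subsets; the search chooses the head and absorbs it
-- into the predicate for the tail.
anyList? : ∀ {v} {P : List (Subset v) → Set} → (∀ L → Dec (P L)) → ∀ n → Dec (∃[ L ] length L ≡ n × P L)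
anyList? P? zero = map′ (λ p → [] , refl , p) (λ { ([] , _ , p) → p }) (P? [])
anyList? P? (suc n) = map′
  (λ (A , L , eq , p) → A ∷ L , cong suc eq , p)
  (λ { (A ∷ L , eq , p) → A , L , suc-injective eq , p })
  (anySubset? (λ A → anyList? (λ L → P? (A ∷ L)) n))

unique? : ∀ {v} (L : List (Subset v)) → Dec (Unique L)
unique? = DecUnique.unique? _≟ₛ_

hasMatching? : ∀ {v} (Bs : List (Subset v)) ρ → Dec (HasMatching Bs ρ)
hasMatching? Bs ρ = anyList? (λ M → unique? M ×-dec
  (All.all? (λ C → Any.any? (C ≟ₛ_) Bs) M ×-dec AllPairs.allPairs? disjoint? M)) ρ

-- The fields of `Packing` as finite conjunctions over lists and points, hence decidable.
LinearBlocks : ∀ {v} → ℕ → List (Subset v) → Set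
LinearBlocks k L = Unique L × All (λ C → ∣ C ∣ ≡ k) L ×
  All (λ C → All (λ D → ∀ x y → x ≢ y → x ∈ C → y ∈ C → x ∈ D → y ∈ D → C ≡ D) L) L

linearBlocks? : ∀ {v} k (L : List (Subset v)) → Dec (LinearBlocks k L)
linearBlocks? k L = unique? L ×-dec (All.all? (λ C → ∣ C ∣ ≟ k) L ×-dec
  All.all? (λ C → All.all? (λ D → Fin.all? (λ x → Fin.all? (λ y → ¬? (x Fin.≟ y) →-dec
    ((x ∈? C) →-dec ((y ∈? C) →-dec ((x ∈? D) →-dec ((y ∈? D) →-dec (C ≟ₛ D)))))))) L) L)

toPacking : ∀ {v k} (L : List (Subset v)) → LinearBlocks k L → Packing v k
toPacking L (u , s , p) = record { blocks = L ; blocks-unique = u ; blocks-size = s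
  ; pair-in-≤1 = λ x≢y A∈ B∈ → All.lookup (All.lookup p A∈) B∈ _ _ x≢y }

fromPacking : ∀ {v k} (𝓟 : Packing v k) → LinearBlocks k (blocks 𝓟)
fromPacking 𝓟 = blocks-unique 𝓟 , blocks-size 𝓟 ,
  All.tabulate (λ A∈ → All.tabulate (λ B∈ _ _ x≢y → pair-in-≤1 𝓟 x≢y A∈ B∈))

Attained : ℕ → ℕ → ℕ → ℕ → Set
Attained ρ v k b = ∃[ 𝓟 ] MaxPPCSize {v} {k} 𝓟 ρ × #blocks 𝓟 ≡ b

-- A constructive maximum needs a decision for each block count `b`; here all lists of `b` subsets
-- are tried.
attained? : ∀ ρ v k b → Dec (Attained ρ v k b)
attained? ρ v k b = map′
  (λ (L , eq , lin , has , ¬has) → let 𝓟 = toPacking L lin in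
    𝓟 , (HasMatching⇒HasPPC 𝓟 has , ¬has ∘ HasPPC⇒HasMatching 𝓟) , eq)
  (λ (𝓟 , (has , ¬has) , eq) →
    blocks 𝓟 , eq , fromPacking 𝓟 , HasPPC⇒HasMatching 𝓟 has , ¬has ∘ HasMatching⇒HasPPC 𝓟)
  (anyList? (λ L → linearBlocks? k L ×-dec (hasMatching? L ρ ×-dec ¬? (hasMatching? L (suc ρ)))) b)

-- Descent from `u`: each value where `Q` fails lowers the bound by one. The given witness prevents
-- the descent from passing zero.
maximum : {Q : ℕ → Set} → (∀ n → Dec (Q n)) → ∀ u → (∀ {n} → Q n → n ≤ u) → ∃ Q →
  ∃[ b ] Q b × (∀ {n} → Q n → n ≤ b)
maximum Q? u bounded q with Q? u
... | yes qu = u , qu , bounded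
maximum {Q} Q? zero bounded (n , qn) | no ¬q0 = contradiction (subst Q (n≤0⇒n≡0 (bounded qn)) qn) ¬q0
maximum {Q} Q? (suc u) bounded q | no ¬qu =
  maximum Q? u (λ qn → ≤-pred (≤∧≢⇒< (bounded qn) (λ { refl → ¬qu qn }))) q

-- The upper bound starts the descent and the attained `b₀` guarantees that it stops; the same two
-- facts then enclose `b`.
β-exists : ∀ {ρ v k u b₀} → ((𝓟 : Packing v k) → MaxPPCSize 𝓟 ρ → #blocks 𝓟 ≤ u) → Attained ρ v k b₀ →
  ∃[ b ] β⟨ ρ , v , k ⟩≡ b × b₀ ≤ b × b ≤ u
β-exists {ρ} {v} {k} {u} ub att
  with maximum (attained? ρ v k) u (λ { (𝓟 , max , refl) → ub 𝓟 max }) (_ , att)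
... | b , (𝓟 , max , refl) , greatest =
  b , ((𝓟 , max , refl) , λ 𝓠 max′ → greatest (𝓠 , max′ , refl)) , greatest att , ub 𝓟 max

-- The two pencils of the lower bound.

fromList : ∀ {v} → List (Fin v) → Subset v
fromList [] = ∅
fromList (x ∷ xs) = ⁅ x ⁆ ∪ fromList xs

∈-fromList⁺ : ∀ {v} {xs : List (Fin v)} {x} → x List.∈ xs → x ∈ fromList xs
∈-fromList⁺ {x = x} (here refl) = x∈p∪q⁺ (inj₁ (x∈⁅x⁆ x))
∈-fromList⁺ (there x∈) = x∈p∪q⁺ (inj₂ (∈-fromList⁺ x∈))

∈-fromList⁻ : ∀ {v} (xs : List (Fin v)) {x} → x ∈ fromList xs → x List.∈ xs
∈-fromList⁻ [] x∈ = contradiction x∈ ∉⊥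
∈-fromList⁻ (y ∷ xs) x∈ with x∈p∪q⁻ ⁅ y ⁆ (fromList xs) x∈
... | inj₁ x∈y = here (x∈⁅y⁆⇒x≡y y x∈y)
... | inj₂ x∈xs = there (∈-fromList⁻ xs x∈xs)

∣fromList∣ : ∀ {v} {xs : List (Fin v)} → Unique xs → ∣ fromList xs ∣ ≡ length xs
∣fromList∣ {xs = xs} u = trans (sym (length-elements (fromList xs))) (≤-antisym
  (unique-⊆⇒length≤ (elements-unique (fromList xs))
    (λ x∈ → ∈-fromList⁻ xs (∈-elements⁻ (fromList xs) x∈)))
  (unique-⊆⇒length≤ u (λ x∈ → ∈-elements⁺ (∈-fromList⁺ x∈))))

module TwoPencils (m n : ℕ) (0<n : 0 < n) (n<m : n < m) where

  -- `zero` and `suc zero` stand for ∞₁ and ∞₂; the numbered points follow, shifted by 2.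
  point : Fin (m * n) → Fin (2 + m * n)
  point p = suc (suc p)

  rowPoint : Fin m → Fin n → Fin (2 + m * n)
  rowPoint i j = point (combine i j)

  -- `combine a c` is `m * a + c`, so a fixed `c` gives the residue class of `c` modulo `m`. The
  -- `cast` only reconciles `n * m` with `m * n`.
  columnPoint : Fin m → Fin n → Fin (2 + m * n)
  columnPoint c a = point (cast (*-comm n m) (combine a c))

  row column : Fin m → List (Fin (2 + m * n))
  row i = zero ∷ tabulate (rowPoint i)
  column c = suc zero ∷ tabulate (columnPoint c)

  rowPoint-injective : ∀ {i j i′ j′} → rowPoint i j ≡ rowPoint i′ j′ → i ≡ i′ × j ≡ j′
  rowPoint-injective eq = Fin.combine-injective _ _ _ _ (Fin.suc-injective (Fin.suc-injective eq))

  toℕ-columnPoint : ∀ c a → toℕ (columnPoint c a) ≡ 2 + (m * toℕ a + toℕ c)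
  toℕ-columnPoint c a = cong (2 +_) (trans (Fin.toℕ-cast _ (combine a c)) (Fin.toℕ-combine a c))

  toℕ-rowPoint : ∀ i j → toℕ (rowPoint i j) ≡ 2 + (n * toℕ i + toℕ j)
  toℕ-rowPoint i j = cong (2 +_) (Fin.toℕ-combine i j)

  columnPoint-injective : ∀ {c a c′ a′} → columnPoint c a ≡ columnPoint c′ a′ → a ≡ a′ × c ≡ c′
  columnPoint-injective {c} {a} {c′} {a′} eq = Fin.combine-injective a c a′ c′ (Fin.toℕ-injective
    (trans (sym (Fin.toℕ-cast _ (combine a c))) (trans (cong toℕ (Fin.suc-injective (Fin.suc-injective eq)))
      (Fin.toℕ-cast _ (combine a′ c′)))))

  position : ∀ {i j c a} → rowPoint i j ≡ columnPoint c a → n * toℕ i + toℕ j ≡ m * toℕ a + toℕ c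
  position {i} {j} {c} {a} eq = +-cancelˡ-≡ 2 _ _
    (trans (sym (toℕ-rowPoint i j)) (trans (cong toℕ eq) (toℕ-columnPoint c a)))

  -- Points of one row differ by less than n, points of one column by a multiple of m > n.
  ¬row-meets-column-later : ∀ {i j j′ c a a′} → rowPoint i j ≡ columnPoint c a →
    rowPoint i j′ ≡ columnPoint c a′ →
    ¬ a Fin.< a′
  ¬row-meets-column-later {i} {j} {j′} {c} {a} {a′} e e′ a<a′ = <-irrefl refl (begin-strict
    m * toℕ a′ + toℕ c          ≡⟨ position e′ ⟨
    n * toℕ i + toℕ j′          <⟨ +-monoʳ-< (n * toℕ i) (<-trans (Fin.toℕ<n j′) n<m) ⟩
    n * toℕ i + m               ≤⟨ +-monoˡ-≤ m (m≤m+n (n * toℕ i) (toℕ j)) ⟩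
    n * toℕ i + toℕ j + m       ≡⟨ cong (_+ m) (position e) ⟩
    m * toℕ a + toℕ c + m       ≡⟨ +-comm _ m ⟩
    m + (m * toℕ a + toℕ c)     ≡⟨ +-assoc m _ _ ⟨
    m + m * toℕ a + toℕ c       ≡⟨ cong (_+ toℕ c) (*-suc m (toℕ a)) ⟨
    m * suc (toℕ a) + toℕ c     ≤⟨ +-monoˡ-≤ (toℕ c) (*-monoʳ-≤ m a<a′) ⟩
    m * toℕ a′ + toℕ c          ∎)
    where
    open ≤-Reasoning

  -- A column does not contain ∞₁ and a row does not contain ∞₂, so both common points are numbered.
  -- If they differed, so would their indices `a` and `a′` in the column, and they would lie too far
  -- apart for one row.
  row-column : ∀ {i c x y} → x List.∈ row i → y List.∈ row i → x List.∈ column c → y List.∈ column c → x ≡ y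
  row-column (here refl) _ (there x∈) _ with ∈-tabulate⁻ x∈
  ... | _ , ()
  row-column (there x∈) _ (here refl) _ with ∈-tabulate⁻ x∈
  ... | _ , ()
  row-column (there _) (here refl) _ (there y∈) with ∈-tabulate⁻ y∈
  ... | _ , ()
  row-column (there _) (there y∈) _ (here refl) with ∈-tabulate⁻ y∈
  ... | _ , ()
  row-column (there x∈) (there y∈) (there x∈′) (there y∈′)
    with ∈-tabulate⁻ x∈ | ∈-tabulate⁻ y∈ | ∈-tabulate⁻ x∈′ | ∈-tabulate⁻ y∈′
  ... | j , refl | j′ , refl | a , ex | a′ , ey with Fin.<-cmp a a′
  ... | tri< a<a′ _ _ = contradiction a<a′ (¬row-meets-column-later ex ey)
  ... | tri≈ _ refl _ = trans ex (sym ey)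
  ... | tri> _ _ a′<a = contradiction a′<a (¬row-meets-column-later ey ex)

  row-row : ∀ {i i′ x} → x List.∈ row i → x List.∈ row i′ → x ≡ zero ⊎ i ≡ i′
  row-row (here eq) _ = inj₁ eq
  row-row (there _) (here eq) = inj₁ eq
  row-row (there x∈) (there x∈′) with ∈-tabulate⁻ x∈ | ∈-tabulate⁻ x∈′
  ... | _ , refl | _ , eq = inj₂ (proj₁ (rowPoint-injective eq))

  column-column : ∀ {c c′ x} → x List.∈ column c → x List.∈ column c′ → x ≡ suc zero ⊎ c ≡ c′
  column-column (here eq) _ = inj₁ eq
  column-column (there _) (here eq) = inj₁ eq
  column-column (there x∈) (there x∈′) with ∈-tabulate⁻ x∈ | ∈-tabulate⁻ x∈′
  ... | _ , refl | _ , eq = inj₂ (proj₂ (columnPoint-injective eq))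

  rowBlock columnBlock : Fin m → Subset (2 + m * n)
  rowBlock i = fromList (row i)
  columnBlock c = fromList (column c)

  Bs : List (Subset (2 + m * n))
  Bs = tabulate rowBlock ++ tabulate columnBlock

  blocks-cases : ∀ {C} → C List.∈ Bs → (∃[ i ] C ≡ rowBlock i) ⊎ (∃[ c ] C ≡ columnBlock c)
  blocks-cases C∈ with ∈-++⁻ (tabulate rowBlock) C∈
  ... | inj₁ r = inj₁ (∈-tabulate⁻ r)
  ... | inj₂ c = inj₂ (∈-tabulate⁻ c)

  rowBlock∈ : ∀ i → rowBlock i List.∈ Bs
  rowBlock∈ i = ∈-++⁺ˡ (∈-tabulate⁺ i)

  columnBlock∈ : ∀ c → columnBlock c List.∈ Bs
  columnBlock∈ c = ∈-++⁺ʳ (tabulate rowBlock) (∈-tabulate⁺ c)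

  -- The numbered point at index 0, which exists by `0<n`, lies in both rows and is not ∞₁, so the
  -- rows agree.
  rowBlock-injective : ∀ {i i′} → rowBlock i ≡ rowBlock i′ → i ≡ i′
  rowBlock-injective {i} {i′} eq
    with row-row (there (∈-tabulate⁺ (fromℕ< 0<n)))
      (∈-fromList⁻ (row i′) (subst (rowPoint i (fromℕ< 0<n) ∈_) eq
        (∈-fromList⁺ {xs = row i} (there (∈-tabulate⁺ (fromℕ< 0<n))))))
  ... | inj₂ i≡i′ = i≡i′

  columnBlock-injective : ∀ {c c′} → columnBlock c ≡ columnBlock c′ → c ≡ c′
  columnBlock-injective {c} {c′} eq
    with column-column (there (∈-tabulate⁺ (fromℕ< 0<n)))
      (∈-fromList⁻ (column c′) (subst (columnPoint c (fromℕ< 0<n) ∈_) eq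
        (∈-fromList⁺ {xs = column c} (there (∈-tabulate⁺ (fromℕ< 0<n))))))
  ... | inj₂ c≡c′ = c≡c′

  zero∉columnBlock : ∀ c → zero ∉ columnBlock c
  zero∉columnBlock c 0∈ with ∈-fromList⁻ (column c) 0∈
  ... | there 0∈′ with ∈-tabulate⁻ 0∈′
  ...   | _ , ()

  ∣rowBlock∣ : ∀ i → ∣ rowBlock i ∣ ≡ suc n
  ∣rowBlock∣ i = trans (∣fromList∣ {xs = row i}
      (All.tabulate⁺ (λ _ ()) ∷ Unique.tabulate⁺ (proj₂ ∘ rowPoint-injective)))
    (cong suc (length-tabulate (rowPoint i)))

  ∣columnBlock∣ : ∀ c → ∣ columnBlock c ∣ ≡ suc n
  ∣columnBlock∣ c = trans (∣fromList∣ {xs = column c}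
      (All.tabulate⁺ (λ _ ()) ∷ Unique.tabulate⁺ (proj₁ ∘ columnPoint-injective)))
    (cong suc (length-tabulate (columnPoint c)))

  -- Two different rows share only ∞₁, two different columns only ∞₂, and a row and a column at most
  -- one point.
  pair-in-≤1-block : ∀ {x y} → x ≢ y → ∀ {A B} → A List.∈ Bs → B List.∈ Bs →
    x ∈ A → y ∈ A → x ∈ B → y ∈ B → A ≡ B
  pair-in-≤1-block x≢y A∈ B∈ x∈A y∈A x∈B y∈B with blocks-cases A∈ | blocks-cases B∈
  ... | inj₁ (i , refl) | inj₂ (c , refl) = contradiction
    (row-column (∈-fromList⁻ (row i) x∈A) (∈-fromList⁻ (row i) y∈A)
      (∈-fromList⁻ (column c) x∈B) (∈-fromList⁻ (column c) y∈B)) x≢y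
  ... | inj₂ (c , refl) | inj₁ (i , refl) = contradiction
    (row-column (∈-fromList⁻ (row i) x∈B) (∈-fromList⁻ (row i) y∈B)
      (∈-fromList⁻ (column c) x∈A) (∈-fromList⁻ (column c) y∈A)) x≢y
  ... | inj₁ (i , refl) | inj₁ (i′ , refl)
    with row-row (∈-fromList⁻ (row i) x∈A) (∈-fromList⁻ (row i′) x∈B)
       | row-row (∈-fromList⁻ (row i) y∈A) (∈-fromList⁻ (row i′) y∈B)
  ...   | inj₂ refl | _ = refl
  ...   | inj₁ _ | inj₂ refl = refl
  ...   | inj₁ x≡0 | inj₁ y≡0 = contradiction (trans x≡0 (sym y≡0)) x≢y
  pair-in-≤1-block x≢y A∈ B∈ x∈A y∈A x∈B y∈B | inj₂ (c , refl) | inj₂ (c′ , refl)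
    with column-column (∈-fromList⁻ (column c) x∈A) (∈-fromList⁻ (column c′) x∈B)
       | column-column (∈-fromList⁻ (column c) y∈A) (∈-fromList⁻ (column c′) y∈B)
  ...   | inj₂ refl | _ = refl
  ...   | inj₁ _ | inj₂ refl = refl
  ...   | inj₁ x≡1 | inj₁ y≡1 = contradiction (trans x≡1 (sym y≡1)) x≢y

  packing : Packing (2 + m * n) (suc n)
  packing = record
    { blocks = Bs
    ; blocks-unique = Unique.++⁺ (Unique.tabulate⁺ rowBlock-injective)
        (Unique.tabulate⁺ columnBlock-injective) distinct
    ; blocks-size = All.++⁺ (All.tabulate⁺ ∣rowBlock∣) (All.tabulate⁺ ∣columnBlock∣)
    ; pair-in-≤1 = pair-in-≤1-block
    }
    where
    distinct : ∀ {C} → ¬ (C List.∈ tabulate rowBlock × C List.∈ tabulate columnBlock)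
    distinct (r , c) with ∈-tabulate⁻ r | ∈-tabulate⁻ c
    ... | i , refl | c , eq = zero∉columnBlock c (subst (zero ∈_) eq (∈-fromList⁺ {xs = row i} (here refl)))

  #packing : #blocks packing ≡ 2 * m
  #packing = trans (length-++ (tabulate rowBlock))
    (trans (cong₂ _+_ (length-tabulate rowBlock) (length-tabulate columnBlock))
      (cong (m +_) (sym (+-identityʳ m))))

  -- ∞₁ and ∞₂ together hit every block. Of three blocks, two contain the same one of them and so
  -- are not disjoint.
  Hit : Subset (2 + m * n) → Set
  Hit C = zero ∈ C ⊎ suc zero ∈ C

  hit : ∀ {C} → C List.∈ Bs → Hit C
  hit C∈ with blocks-cases C∈
  ... | inj₁ (i , refl) = inj₁ (∈-fromList⁺ {xs = row i} (here refl))
  ... | inj₂ (c , refl) = inj₂ (∈-fromList⁺ {xs = column c} (here refl))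

  maxPPCSize : MaxPPCSize packing 2
  maxPPCSize = HasMatching⇒HasPPC packing two , three ∘ HasPPC⇒HasMatching packing
    where
    i₀ c₀ : Fin m
    i₀ = fromℕ< (≤-trans (s≤s z≤n) n<m)
    c₀ = fromℕ< n<m
    -- The points of row 0 are numbered below n, those of column n are not.
    apart : ∀ {j a} → rowPoint i₀ j ≢ columnPoint c₀ a
    apart {j} {a} eq = <-irrefl refl (begin-strict
      n                         ≡⟨ Fin.toℕ-fromℕ< n<m ⟨
      toℕ c₀                    ≤⟨ m≤n+m (toℕ c₀) (m * toℕ a) ⟩
      m * toℕ a + toℕ c₀        ≡⟨ position eq ⟨
      n * toℕ i₀ + toℕ j        ≡⟨ cong (λ z → n * z + toℕ j) (Fin.toℕ-fromℕ< _) ⟩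
      n * 0 + toℕ j             ≡⟨ cong (_+ toℕ j) (*-zeroʳ n) ⟩
      toℕ j                     <⟨ Fin.toℕ<n j ⟩
      n                         ∎)
      where open ≤-Reasoning
    disjoint : Disjoint (rowBlock i₀) (columnBlock c₀)
    disjoint (x , x∈) with x∈p∩q⁻ (rowBlock i₀) (columnBlock c₀) x∈
    ... | x∈r , x∈c with ∈-fromList⁻ (row i₀) x∈r | ∈-fromList⁻ (column c₀) x∈c
    ...   | here refl | _ = zero∉columnBlock c₀ x∈c
    ...   | there x∈r′ | here refl with ∈-tabulate⁻ x∈r′
    ...     | _ , ()
    disjoint (x , x∈) | x∈r , x∈c | there x∈r′ | there x∈c′ with ∈-tabulate⁻ x∈r′ | ∈-tabulate⁻ x∈c′
    ...   | _ , refl | _ , eq = apart eq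
    two : HasMatching Bs 2
    two = rowBlock i₀ ∷ columnBlock c₀ ∷ [] , refl
      , (disjoint-blocks-≢ packing (rowBlock∈ i₀) disjoint ∷ []) ∷ [] ∷ []
      , rowBlock∈ i₀ ∷ columnBlock∈ c₀ ∷ [] , (disjoint ∷ []) ∷ [] ∷ []
    common : ∀ {x C D} → x ∈ C → x ∈ D → ¬ Disjoint C D
    common x∈C x∈D C#D = C#D (_ , x∈p∩q⁺ (x∈C , x∈D))
    three : ¬ HasMatching Bs 3
    three (C ∷ D ∷ E ∷ [] , refl , _ , C∈ ∷ D∈ ∷ E∈ ∷ [] , (C#D ∷ C#E ∷ []) ∷ (D#E ∷ []) ∷ _)
      with hit C∈ | hit D∈ | hit E∈
    ... | inj₁ c | inj₁ d | _ = common c d C#D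
    ... | inj₂ c | inj₂ d | _ = common c d C#D
    ... | inj₁ c | inj₂ _ | inj₁ e = common c e C#E
    ... | inj₁ _ | inj₂ d | inj₂ e = common d e D#E
    ... | inj₂ c | inj₁ _ | inj₂ e = common c e C#E
    ... | inj₂ _ | inj₁ d | inj₁ e = common d e D#E

-- From the congruence and the size of `v` to the parameters `m` and `n`.

-- Removing the common remainder from `a + w` and from `a` leaves multiples of `n` that differ by
-- `w`.
%≡%⇒multiple : ∀ a w n .{{_ : NonZero n}} → (a + w) % n ≡ a % n → ∃[ m ] w ≡ m * n
%≡%⇒multiple a w n eq = quotient n∣w , _∣_.equality n∣w
  where
  n∣w : n ∣ w
  n∣w = ∣m+n∣m⇒∣n {m = a / n * n} (divides ((a + w) / n) (+-cancelˡ-≡ (a % n) _ _ (begin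
    a % n + (a / n * n + w)           ≡⟨ +-assoc (a % n) _ w ⟨
    a % n + a / n * n + w             ≡⟨ cong (_+ w) (m≡m%n+[m/n]*n a n) ⟨
    a + w                             ≡⟨ m≡m%n+[m/n]*n (a + w) n ⟩
    (a + w) % n + (a + w) / n * n     ≡⟨ cong (_+ (a + w) / n * n) eq ⟩
    a % n + (a + w) / n * n           ∎))) (n∣m*n (a / n))
    where open ≡-Reasoning

β-bounds : ∀ n m .{{_ : NonZero n}} → n * n + n + 2 ≤ m →
  ∃[ b ] β⟨ 2 , 2 + m * n , suc n ⟩≡ b × 2 * m ≤ b × b ≤ 2 * m + (suc n ^ 2 ∸ 2)
β-bounds n m m-large =
  β-exists (upper-bound n m m-large) (packing , maxPPCSize , #packing)
  where
  open TwoPencils m n (>-nonZero⁻¹ n)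
    -- This is `n < m`, from `n < n * n + n + 2`.
    (<-≤-trans (≤-<-trans (m≤n+m n (n * n)) (m<m+n (n * n + n) (s≤s z≤n))) m-large)

-- The left side of the hypothesis, which is `k * (k ∸ 1) ^ 2 + 2 * k` for `k = suc n`, equals
-- `2 + (n * n + n + 2) * n`; cancelling 2 and the factor `n` gives the bound on `m`.
quotient-large : ∀ n m .{{_ : NonZero n}} → suc n * n ^ 2 + 2 * suc n ≤ 2 + m * n → n * n + n + 2 ≤ m
quotient-large n m v-large = *-cancelʳ-≤ (n * n + n + 2) m n
  (+-cancelˡ-≤ 2 _ _ (≤-trans (≤-reflexive (expand n)) v-large))
  where
  expand : ∀ n → 2 + (n * n + n + 2) * n ≡ (1 + n) * (n * (n * 1)) + 2 * (1 + n)
  expand = solve-∀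

theorem5p6 : ∀ (k v : ℕ) (k≥2 : k ≥ 2) →
    let instance
          k∸1≢0 : NonZero (k ∸ 1)
          k∸1≢0 = k∸1-nonZero k≥2
    in
    v % (k ∸ 1) ≡ 2 % (k ∸ 1) →
    v ≥ k * (k ∸ 1) ^ 2 + 2 * k →
    ∃[ b ] β⟨ 2 , v , k ⟩≡ b ×
      (2 * v ∸ 4) / (k ∸ 1) ≤ b ×
      b ≤ (2 * v ∸ 4) / (k ∸ 1) + (k ^ 2 ∸ 2)
theorem5p6 k@(suc n@(suc n′)) v (s≤s (s≤s z≤n)) v≡2 v-large
  -- Since `v ≥ 2 * k ≥ 2`, it can be written as `2 + w`; the congruence then makes `w` a multiple
  -- of `n`.
  with m≤n⇒∃[o]m+o≡n {2} {v} (≤-trans (≤-trans (m≤m*n 2 k) (m≤n+m (2 * k) (k * n ^ 2))) v-large)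
... | w , refl with %≡%⇒multiple 2 w n v≡2
... | m , refl = subst (λ q → ∃[ b ] β⟨ 2 , 2 + m * n , k ⟩≡ b × q ≤ b × b ≤ q + (k ^ 2 ∸ 2)) (sym quotient≡)
  (β-bounds n m (quotient-large n m v-large))
  where
  -- The numerator is exactly `2 * m * n`, so the subtraction is not truncated and the division does
  -- not round.
  quotient≡ : (2 * (2 + m * n) ∸ 4) / n ≡ 2 * m
  quotient≡ = trans (cong (_/ n) (trans (cong (_∸ 4) (*-distribˡ-+ 2 2 (m * n))) (sym (*-assoc 2 m n))))
    (m*n/n≡m (2 * m) n)
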